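{- Every $n$-vertex stacked triangulation with $n \geq 4$ has an edge guard set of size at most $\lfloor 2n/7 \rfloor$.
   Context: A plane graph is a simple graph together with a crossing-free embedding in $\mathbb{R}^2$. Stacked triangulations are defined recursively: (i) a triangle (a plane $3$-cycle) is a stacked triangulation; (ii) if $G$ is a stacked triangulation and $f=(x,y,z)$ is an inner face, then the plane graph obtained by placing a new vertex $v$ inside $f$ and joining it to $x,y,z$ is a stacked triangulation. For a plane graph $G=(V,E)$, a face $f$ is guarded by an edge $vw \in E$ if at least one of $v,w$ lies on the boundary of $f$. A set $\Gamma \subseteq E$ is an edge guard set if every face of $G$ (including the outer face) is guarded by some edge of $\Gamma$. -}

module Defs where

open import Data.Nat using (ℕ; suc; _≤_; _*_; _/_)
open import Data.Product using (_×_; _,_; proj₁; proj₂; ∃-syntax)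
open import Data.Sum using (_⊎_)
open import Data.List using (List; []; _∷_; _++_; length)
open import Data.List.Relation.Unary.All using (All)
open import Data.List.Relation.Unary.Any using (Any)
open import Data.List.Relation.Binary.Subset.Propositional using (_⊆_)
open import Relation.Binary.PropositionalEquality using (_≡_)

-- Vertices are natural numbers; an n-vertex graph has vertex set {0,…,n-1}.
Vertex : Set
Vertex = ℕ

-- An edge {v,w} (stored as an ordered pair).
Edge : Set
Edge = Vertex × Vertex

Face : Set
Face = Vertex × Vertex × Vertex

outerFace : Face
outerFace = 0 , 1 , 2

-- Stacked n E F : the recursive construction yields a stacked triangulation
-- with vertex set {0,…,n-1}, edge list E and list F of INNER faces.
-- The faces of the plane graph are exactly outerFace ∷ F.
data Stacked : ℕ → List Edge → List Face → Set where
  triangle : Stacked 3 ((0 , 1) ∷ (1 , 2) ∷ (0 , 2) ∷ [])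
                       (outerFace ∷ [])
  stack : ∀ {n E} (F₁ F₂ : List Face) (x y z : Vertex) →
          Stacked n E (F₁ ++ (x , y , z) ∷ F₂) →
          Stacked (suc n)
                  ((x , n) ∷ (y , n) ∷ (z , n) ∷ E)
                  (F₁ ++ (x , y , n) ∷ (y , z , n) ∷ (x , z , n) ∷ F₂)

OnBoundary : Vertex → Face → Set
OnBoundary v (a , b , c) = v ≡ a ⊎ v ≡ b ⊎ v ≡ c

GuardedBy : Face → Edge → Set
GuardedBy f (v , w) = OnBoundary v f ⊎ OnBoundary w f

IsEdgeGuardSet : List Edge → List Face → List Edge → Set
IsEdgeGuardSet E Fs Γ = Γ ⊆ E × All (λ f → Any (GuardedBy f) Γ) Fs

{-# OPTIONS --safe #-}

-- The vertices stacked inside a triangle form a ternary tree, and a choice of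
-- edges inside it matters to the rest of the graph only through which corners
-- it relies on, which corners it covers, and how many edges it uses.  So a tree
-- is summarised by a profile, a list of such guarantees, with its cost measured
-- relative to 2/7 of its size.  Ten profiles suffice: whenever the three subtrees
-- of a node have one of them, so does the node, after buying at most one of
-- the three edges at its central vertex.  This closure is a finite check.  At
-- the root, at most one outer edge completes the guard set.

module Submission where

open import Defs
open import Data.Nat using (ℕ; suc; NonZero; _+_; _≤_; _*_; _/_; z≤n; s≤s; _≤?_)
open import Data.Nat.Properties
  using (module ≤-Reasoning; +-mono-≤; +-cancelˡ-≤; *-comm; +-suc; +-assoc)
open import Data.Nat.DivMod using (/-monoˡ-≤; m*n/n≡m)
open import Data.Nat.Tactic.RingSolver using (solve-∀)
open import Data.Fin using (Fin; inject₁; toℕ; _≟_)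
open import Data.Fin.Patterns using (0F; 1F; 2F; 3F)
open import Data.Product using (_×_; _,_; ∃-syntax; proj₁; proj₂; map; map₁; map₂)
open import Data.Sum using (_⊎_; inj₁; inj₂)
open import Data.List using (List; []; _∷_; [_]; _++_; length; concatMap)
import Data.Sum as Sum
import Data.List as List
open import Data.List.Properties using (++-assoc; length-++; length-map; ∷-injective)
open import Data.List.Membership.Propositional using (_∈_; find)
open import Data.List.Membership.Propositional.Properties using (∈-map⁻; ∈-++⁺ˡ; ∈-++⁺ʳ; ∈-++⁻)
import Data.List.Membership.DecPropositional as DecMembership
open import Data.List.Relation.Binary.Subset.Propositional using (_⊆_)
open import Data.List.Relation.Binary.Subset.Propositional.Properties
  using (⊆-refl; ⊆-reflexive; ⊆-trans; xs⊆xs++ys; xs⊆ys++xs; ++⁺; map⁺; Any-resp-⊆)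
open import Data.List.Relation.Unary.All as All using (All; []; _∷_)
import Data.List.Relation.Unary.All.Properties as All
open import Data.List.Relation.Unary.Any as Any using (Any; here; there)
open import Data.Unit using (⊤)
open import Function using (_∘_)
open import Relation.Nullary.Decidable using (Dec; yes; toWitness; _×-dec_)
open import Relation.Binary.PropositionalEquality
  using (_≡_; refl; sym; trans; cong; cong₂; subst)

-- Triangulations as ternary trees.

Covered : List Edge → Vertex → Set
Covered Γ v = Any (λ e → let (a , b) = e in v ≡ a ⊎ v ≡ b) Γ

Triangle : Set
Triangle = Fin 3 → Vertex

face : Triangle → Face
face T = T 0F , T 1F , T 2F

data Tree : Set where
  leaf : Tree
  node : Vertex → Tree → Tree → Tree → Tree

extend : Triangle → Vertex → Fin 4 → Vertex
extend T v 0F = T 0F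
extend T v 1F = T 1F
extend T v 2F = T 2F
extend T v 3F = v

extend-inject₁ : ∀ T v i → extend T v (inject₁ i) ≡ T i
extend-inject₁ T v 0F = refl
extend-inject₁ T v 1F = refl
extend-inject₁ T v 2F = refl

-- The triangles and their corners follow the order used by `stack`, central vertex last, so
-- stacking into a leaf yields the prescribed faces definitionally.
sub₁ sub₂ sub₃ : Fin 3 → Fin 4
sub₁ 0F = 0F
sub₁ 1F = 1F
sub₁ 2F = 3F
sub₂ 0F = 1F
sub₂ 1F = 2F
sub₂ 2F = 3F
sub₃ 0F = 0F
sub₃ 1F = 2F
sub₃ 2F = 3F

spokes : List (Fin 4 × Fin 4)
spokes = (0F , 3F) ∷ (1F , 3F) ∷ (2F , 3F) ∷ []

sides : List (Fin 3 × Fin 3)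
sides = (0F , 1F) ∷ (1F , 2F) ∷ (0F , 2F) ∷ []

realise : ∀ {n} → (Fin n → Vertex) → List (Fin n × Fin n) → List Edge
realise q = List.map (map q q)

size : Tree → ℕ
size leaf = 0
size (node _ t₁ t₂ t₃) = suc (size t₁ + size t₂ + size t₃)

faces : Triangle → Tree → List Face
faces T leaf = [ face T ]
faces T (node v t₁ t₂ t₃) =
  faces (extend T v ∘ sub₁) t₁ ++ faces (extend T v ∘ sub₂) t₂ ++ faces (extend T v ∘ sub₃) t₃

edges : Triangle → Tree → List Edge
edges T leaf = []
edges T (node v t₁ t₂ t₃) =
  realise (extend T v) spokes ++
  edges (extend T v ∘ sub₁) t₁ ++ edges (extend T v ∘ sub₂) t₂ ++ edges (extend T v ∘ sub₃) t₃

-- Guarantees and profiles.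

record Guarantee : Set where
  constructor ⟨_,_,_⟩
  field
    assumed  : List (Fin 3)
    provided : List (Fin 3)
    cost     : ℕ
open Guarantee

-- Only the excess of the size over `rank` pays for edges, so finitely many profiles can serve trees
-- of every size. A larger `rank` is a stronger claim.
record Profile : Set where
  constructor profile
  field
    rank       : ℕ
    guarantees : List Guarantee
open Profile

-- `guarding` ranges over all supersets because the edges at the assumed corners are chosen
-- elsewhere, in sibling subtrees or further out. `covering` holds for `guards` alone, so siblings
-- may supply corners to each other without circularity.
record Achieves (T : Triangle) (t : Tree) (r : ℕ) (g : Guarantee) : Set where
  field
    guards   : List Edge
    internal : guards ⊆ edges T t
    -- |guards| ≤ cost + 2/7 (size − r), free of subtraction and division.
    few      : 7 * length guards + 2 * r ≤ 2 * size t + 7 * cost g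
    guarding : ∀ {Γ} → guards ⊆ Γ → All (Covered Γ ∘ T) (assumed g) →
               All (λ f → Any (GuardedBy f) Γ) (faces T t)
    covering : All (Covered guards ∘ T) (provided g)
open Achieves

Attains : Triangle → Tree → Profile → Set
Attains T t P = All (Achieves T t (rank P)) (guarantees P)

-- Obtained by closing the leaf profile under the node operation, discarding
-- dominated profiles, and then merging and weakening the survivors as far as
-- closure persists.
leafProfile anyCorner twoCorners threeCorners : Profile
leafProfile  = profile 0 (⟨ [ 0F ] , [] , 0 ⟩ ∷ ⟨ [ 1F ] , [] , 0 ⟩ ∷ ⟨ [ 2F ] , [] , 0 ⟩ ∷ [])
anyCorner    = profile 4 (⟨ [ 0F ] , [] , 1 ⟩ ∷ ⟨ [ 1F ] , [] , 1 ⟩ ∷ ⟨ [ 2F ] , [] , 1 ⟩ ∷ [])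
twoCorners   = profile 1
  (⟨ 0F ∷ 1F ∷ [] , [] , 0 ⟩ ∷ ⟨ 0F ∷ 2F ∷ [] , [] , 0 ⟩ ∷ ⟨ 1F ∷ 2F ∷ [] , [] , 0 ⟩ ∷ [])
threeCorners = profile 4
  (⟨ 0F ∷ 1F ∷ [] , [] , 1 ⟩ ∷ ⟨ 0F ∷ 2F ∷ [] , [] , 1 ⟩ ∷ ⟨ 1F ∷ 2F ∷ [] , [] , 1 ⟩ ∷
   ⟨ 0F ∷ 1F ∷ 2F ∷ [] , [] , 0 ⟩ ∷ [])

-- Up to order, `sideProfile` is symmetric in `i` and `j`, and `apexProfile` in `j` and `k`; three
-- instances of each represent all labellings.
sideProfile apexProfile : (i j k : Fin 3) → Profile
sideProfile i j k = profile 2 (⟨ i ∷ j ∷ [] , [] , 0 ⟩ ∷ ⟨ i ∷ k ∷ [] , [ j ] , 1 ⟩ ∷ ⟨ j ∷ k ∷ [] , [ i ] , 1 ⟩ ∷ [])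
apexProfile i j k = profile 3 (⟨ [] , [ i ] , 1 ⟩ ∷ ⟨ [ i ] , [ j ] , 1 ⟩ ∷ ⟨ [ i ] , [ k ] , 1 ⟩ ∷ [])

nodeProfiles : List Profile
nodeProfiles =
  twoCorners ∷
  sideProfile 0F 1F 2F ∷ sideProfile 0F 2F 1F ∷ sideProfile 1F 2F 0F ∷
  apexProfile 0F 1F 2F ∷ apexProfile 1F 0F 2F ∷ apexProfile 2F 0F 1F ∷
  threeCorners ∷ anyCorner ∷ []

profiles : List Profile
profiles = leafProfile ∷ nodeProfiles

-- One node as a finite check on indices.

ends : ∀ {n} → List (Fin n × Fin n) → List (Fin n)
ends = concatMap (λ e → let (i , j) = e in i ∷ j ∷ [])

atMostOne : ∀ {A : Set} → List A → List (List A)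
atMostOne xs = [] ∷ List.map [_] xs

module _ {n : ℕ} where
  open DecMembership (_≟_ {n}) using (_∈?_) public

supplied : List (Fin 4 × Fin 4) → (g₁ g₂ g₃ : Guarantee) → List (Fin 4)
supplied es g₁ g₂ g₃ =
  ends es ++ List.map sub₁ (provided g₁) ++ List.map sub₂ (provided g₂) ++ List.map sub₃ (provided g₃)

needed : (g₁ g₂ g₃ : Guarantee) → List (Fin 4)
needed g₁ g₂ g₃ =
  List.map sub₁ (assumed g₁) ++ List.map sub₂ (assumed g₂) ++ List.map sub₃ (assumed g₃)

-- Phrased on indices in `Fin 4`, hence decidable without knowing vertices or subtrees. The
-- inequality is what remains of the edge budget once subtree sizes cancel; `suc` counts the central
-- vertex. That vertex is never assumed from outside: if needed, it must be supplied by a spoke or a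
-- subtree.
Combines : (P₁ P₂ P₃ P : Profile) (g₁ g₂ g₃ g : Guarantee) → List (Fin 4 × Fin 4) → Set
Combines P₁ P₂ P₃ P g₁ g₂ g₃ g es =
  7 * (length es + (cost g₁ + cost g₂ + cost g₃)) + 2 * rank P ≤
    2 * suc (rank P₁ + rank P₂ + rank P₃) + 7 * cost g ×
  All (_∈ supplied es g₁ g₂ g₃ ++ List.map inject₁ (assumed g)) (needed g₁ g₂ g₃) ×
  All (_∈ supplied es g₁ g₂ g₃) (List.map inject₁ (provided g))

combines? : ∀ P₁ P₂ P₃ P g₁ g₂ g₃ g es → Dec (Combines P₁ P₂ P₃ P g₁ g₂ g₃ g es)
combines? P₁ P₂ P₃ P g₁ g₂ g₃ g es =
  (_ ≤? _) ×-dec All.all? (_∈? _) _ ×-dec All.all? (_∈? _) _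

-- `P` is fixed by the three subtree profiles, but each of its guarantees may use different subtree
-- guarantees and a different spoke.
Composes : (P₁ P₂ P₃ P : Profile) → Set
Composes P₁ P₂ P₃ P =
  All (λ g → Any (λ g₁ → Any (λ g₂ → Any (λ g₃ → Any
    (Combines P₁ P₂ P₃ P g₁ g₂ g₃ g) (atMostOne spokes))
    (guarantees P₃)) (guarantees P₂)) (guarantees P₁)) (guarantees P)

composes? : ∀ P₁ P₂ P₃ P → Dec (Composes P₁ P₂ P₃ P)
composes? P₁ P₂ P₃ P =
  All.all? (λ g → Any.any? (λ g₁ → Any.any? (λ g₂ → Any.any? (λ g₃ → Any.any?
    (combines? P₁ P₂ P₃ P g₁ g₂ g₃ g) _) _) _) _) _

abstract
  -- All thousand triples are decided by evaluation. Landing in `nodeProfiles` matters, since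
  -- `leafProfile` cannot be completed at the root.
  profiles-closed : All (λ P₁ → All (λ P₂ → All (λ P₃ →
    Any (Composes P₁ P₂ P₃) nodeProfiles) profiles) profiles) profiles
  profiles-closed = toWitness {a? =
    All.all? (λ P₁ → All.all? (λ P₂ → All.all? (λ P₃ → Any.any? (composes? P₁ P₂ P₃) _) _) _) _} _

-- From index checks to actual guard sets.

ends-covered : ∀ {n} (q : Fin n → Vertex) es → All (Covered (realise q es) ∘ q) (ends es)
ends-covered q []       = []
ends-covered q (_ ∷ es) =
  here (inj₁ refl) ∷ here (inj₂ refl) ∷ All.map there (ends-covered q es)

atMostOne-⊆ : ∀ {A : Set} {xs ys : List A} → ys ∈ atMostOne xs → ys ⊆ xs
atMostOne-⊆ (here refl) ()
atMostOne-⊆ (there p) with ∈-map⁻ [_] p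
... | _ , x∈xs , refl = λ { (here refl) → x∈xs }

guardedAt : ∀ T i {Γ} → Covered Γ (T i) → Any (GuardedBy (face T)) Γ
guardedAt T i = Any.map (Sum.map (corner i) (corner i))
  where
  corner : ∀ i {v} → T i ≡ v → OnBoundary v (face T)
  corner 0F eq = inj₁ (sym eq)
  corner 1F eq = inj₂ (inj₁ (sym eq))
  corner 2F eq = inj₂ (inj₂ (sym eq))

leaf-attains : ∀ T → Attains T leaf leafProfile
leaf-attains T = fromCorner 0F ∷ fromCorner 1F ∷ fromCorner 2F ∷ []
  where
  fromCorner : ∀ i → Achieves T leaf 0 ⟨ [ i ] , [] , 0 ⟩
  fromCorner i = record
    { guards   = []
    ; internal = λ ()
    ; few      = z≤n
    ; guarding = λ { _ (c ∷ []) → guardedAt T i c ∷ [] }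
    ; covering = []
    }

pool : ∀ l r s k l′ r′ s′ k′ → 7 * l + 2 * r ≤ 2 * s + 7 * k → 7 * l′ + 2 * r′ ≤ 2 * s′ + 7 * k′ →
  7 * (l + l′) + 2 * (r + r′) ≤ 2 * (s + s′) + 7 * (k + k′)
pool l r s k l′ r′ s′ k′ f f′ = begin
  7 * (l + l′) + 2 * (r + r′)         ≡⟨ regroup 7 2 l r l′ r′ ⟩
  (7 * l + 2 * r) + (7 * l′ + 2 * r′) ≤⟨ +-mono-≤ f f′ ⟩
  (2 * s + 7 * k) + (2 * s′ + 7 * k′) ≡⟨ regroup 2 7 s k s′ k′ ⟨
  2 * (s + s′) + 7 * (k + k′)         ∎
  where
  open ≤-Reasoning

  regroup : ∀ a b x y x′ y′ → a * (x + x′) + b * (y + y′) ≡ (a * x + b * y) + (a * x′ + b * y′)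
  regroup = solve-∀

-- Adding the node's balance to the pooled bound of its subtrees puts the pooled cost `k′` and rank
-- `r′` on both sides, where they cancel.
spend : ∀ e r k l r′ s k′ → 7 * (e + k′) + 2 * r ≤ 2 * suc r′ + 7 * k → 7 * l + 2 * r′ ≤ 2 * s + 7 * k′ →
  7 * (e + l) + 2 * r ≤ 2 * suc s + 7 * k
spend e r k l r′ s k′ c f = +-cancelˡ-≤ (7 * k′ + 2 * r′) _ _ (begin
  7 * k′ + 2 * r′ + (7 * (e + l) + 2 * r)       ≡⟨ split e r l r′ k′ ⟩
  (7 * (e + k′) + 2 * r) + (7 * l + 2 * r′)     ≤⟨ +-mono-≤ c f ⟩
  (2 * suc r′ + 7 * k) + (2 * s + 7 * k′)       ≡⟨ join k r′ s k′ ⟩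
  7 * k′ + 2 * r′ + (2 * suc s + 7 * k)         ∎)
  where
  open ≤-Reasoning

  split : ∀ e r l r′ k′ → 7 * k′ + 2 * r′ + (7 * (e + l) + 2 * r) ≡ (7 * (e + k′) + 2 * r) + (7 * l + 2 * r′)
  split = solve-∀

  join : ∀ k r′ s k′ → (2 * suc r′ + 7 * k) + (2 * s + 7 * k′) ≡ 7 * k′ + 2 * r′ + (2 * suc s + 7 * k)
  join = solve-∀

compose : ∀ {T v t₁ t₂ t₃} P₁ P₂ P₃ P {g₁ g₂ g₃ g es} →
  es ⊆ spokes → Combines P₁ P₂ P₃ P g₁ g₂ g₃ g es →
  Achieves (extend T v ∘ sub₁) t₁ (rank P₁) g₁ →
  Achieves (extend T v ∘ sub₂) t₂ (rank P₂) g₂ →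
  Achieves (extend T v ∘ sub₃) t₃ (rank P₃) g₃ →
  Achieves T (node v t₁ t₂ t₃) (rank P) g
compose {T} {v} {t₁} {t₂} {t₃} P₁ P₂ P₃ P {g₁} {g₂} {g₃} {g} {es} es⊆ (cheap , met , given) a₁ a₂ a₃ = record
  { guards   = Δ
  ; internal = ++⁺ (map⁺ (map q q) es⊆) (++⁺ (internal a₁) (++⁺ (internal a₂) (internal a₃)))
  ; few      = subst (λ l → 7 * l + 2 * rank P ≤ 2 * size (node v t₁ t₂ t₃) + 7 * cost g) (sym length-Δ)
      (spend (length es) (rank P) (cost g)
        (length Γ₁ + length Γ₂ + length Γ₃) (rank P₁ + rank P₂ + rank P₃)
        (size t₁ + size t₂ + size t₃) (cost g₁ + cost g₂ + cost g₃) cheap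
        (pool (length Γ₁ + length Γ₂) (rank P₁ + rank P₂) (size t₁ + size t₂) (cost g₁ + cost g₂)
              (length Γ₃) (rank P₃) (size t₃) (cost g₃)
          (pool (length Γ₁) (rank P₁) (size t₁) (cost g₁) (length Γ₂) (rank P₂) (size t₂) (cost g₂)
            (few a₁) (few a₂))
          (few a₃)))
  ; guarding = guarding′
  ; covering = All.map (λ {i} → subst (Covered Δ) (extend-inject₁ T v i))
      (All.map⁻ (All.map (All.lookup supplied-covered) given))
  }
  where
  q : Fin 4 → Vertex
  q = extend T v

  Γ₀ Γ₁ Γ₂ Γ₃ Δ : List Edge
  Γ₀ = realise q es
  Γ₁ = guards a₁
  Γ₂ = guards a₂
  Γ₃ = guards a₃
  Δ  = Γ₀ ++ Γ₁ ++ Γ₂ ++ Γ₃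

  length-Δ : length Δ ≡ length es + (length Γ₁ + length Γ₂ + length Γ₃)
  length-Δ = trans (length-++ Γ₀) (cong₂ _+_ (length-map (map q q) es)
    (trans (length-++ Γ₁) (trans (cong (length Γ₁ +_) (length-++ Γ₂))
      (sym (+-assoc (length Γ₁) (length Γ₂) (length Γ₃))))))

  Γ₁⊆Δ : Γ₁ ⊆ Δ
  Γ₁⊆Δ = ⊆-trans (xs⊆xs++ys Γ₁ _) (xs⊆ys++xs _ Γ₀)

  Γ₂⊆Δ : Γ₂ ⊆ Δ
  Γ₂⊆Δ = ⊆-trans (xs⊆xs++ys Γ₂ _) (⊆-trans (xs⊆ys++xs _ Γ₁) (xs⊆ys++xs _ Γ₀))

  Γ₃⊆Δ : Γ₃ ⊆ Δ
  Γ₃⊆Δ = ⊆-trans (xs⊆ys++xs _ Γ₂) (⊆-trans (xs⊆ys++xs _ Γ₁) (xs⊆ys++xs _ Γ₀))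

  supplied-covered : All (Covered Δ ∘ q) (supplied es g₁ g₂ g₃)
  supplied-covered =
    All.++⁺ (All.map (Any-resp-⊆ (xs⊆xs++ys Γ₀ _)) (ends-covered q es))
    (All.++⁺ (All.map⁺ (All.map (Any-resp-⊆ Γ₁⊆Δ) (covering a₁)))
    (All.++⁺ (All.map⁺ (All.map (Any-resp-⊆ Γ₂⊆Δ) (covering a₂)))
             (All.map⁺ (All.map (Any-resp-⊆ Γ₃⊆Δ) (covering a₃)))))

  guarding′ : ∀ {Γ} → Δ ⊆ Γ → All (Covered Γ ∘ T) (assumed g) →
              All (λ f → Any (GuardedBy f) Γ) (faces T (node v t₁ t₂ t₃))
  guarding′ {Γ} Δ⊆Γ as =
    All.++⁺ (guarding a₁ (⊆-trans Γ₁⊆Δ Δ⊆Γ) (All.map⁻ (All.++⁻ˡ _ needed-covered)))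
    (All.++⁺ (guarding a₂ (⊆-trans Γ₂⊆Δ Δ⊆Γ)
                (All.map⁻ (All.++⁻ˡ _ (All.++⁻ʳ (List.map sub₁ (assumed g₁)) needed-covered))))
             (guarding a₃ (⊆-trans Γ₃⊆Δ Δ⊆Γ)
                (All.map⁻ (All.++⁻ʳ (List.map sub₂ (assumed g₂))
                            (All.++⁻ʳ (List.map sub₁ (assumed g₁)) needed-covered)))))
    where
    needed-covered : All (Covered Γ ∘ q) (needed g₁ g₂ g₃)
    -- A needed corner is either covered by `Δ` or an assumed corner of `T`, covered by `Γ`.
    needed-covered = All.map (All.lookup (All.++⁺
      (All.map (Any-resp-⊆ Δ⊆Γ) supplied-covered)
      (All.map⁺ (All.map (λ {i} → subst (Covered Γ) (sym (extend-inject₁ T v i))) as)))) met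

attains      : ∀ T t → ∃[ P ] P ∈ profiles × Attains T t P
node-attains : ∀ T v t₁ t₂ t₃ → ∃[ P ] P ∈ nodeProfiles × Attains T (node v t₁ t₂ t₃) P

attains T leaf = leafProfile , here refl , leaf-attains T
attains T (node v t₁ t₂ t₃) = map₂ (map₁ there) (node-attains T v t₁ t₂ t₃)

node-attains T v t₁ t₂ t₃
  with P₁ , P₁∈ , at₁ ← attains (extend T v ∘ sub₁) t₁
     | P₂ , P₂∈ , at₂ ← attains (extend T v ∘ sub₂) t₂
     | P₃ , P₃∈ , at₃ ← attains (extend T v ∘ sub₃) t₃
  with P , P∈ , composes ← find (All.lookup (All.lookup (All.lookup profiles-closed P₁∈) P₂∈) P₃∈)
  = P , P∈ , All.map achieve composes
  where
  achieve : ∀ {g} → Any (λ g₁ → Any (λ g₂ → Any (λ g₃ → Any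
      (Combines P₁ P₂ P₃ P g₁ g₂ g₃ g) (atMostOne spokes))
      (guarantees P₃)) (guarantees P₂)) (guarantees P₁) →
    Achieves T (node v t₁ t₂ t₃) (rank P) g
  achieve any
    with _ , g₁∈ , any₁ ← find any
    with _ , g₂∈ , any₂ ← find any₁
    with _ , g₃∈ , any₃ ← find any₂
    with _ , es∈ , c    ← find any₃
    = compose P₁ P₂ P₃ P (atMostOne-⊆ es∈) c
        (All.lookup at₁ g₁∈) (All.lookup at₂ g₂∈) (All.lookup at₃ g₃∈)

-- Completing the guard set at the root.

-- The 3 counts the outer vertices, which the tree size omits. The last condition is nonemptiness:
-- some outer corner is covered, which guards the outer face.
Finishes : Profile → Guarantee → List (Fin 3 × Fin 3) → Set
Finishes P g es =
  7 * (length es + cost g) ≤ 2 * (3 + rank P) ×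
  All (_∈ ends es) (assumed g) ×
  Any (λ _ → ⊤) (ends es ++ provided g)

finishes? : ∀ P g es → Dec (Finishes P g es)
finishes? P g es =
  (_ ≤? _) ×-dec All.all? (_∈? _) _ ×-dec Any.any? (λ _ → yes _) _

abstract
  -- `leafProfile` would fail: its assumed corner needs a side, costing 7 against a budget of 6. For
  -- `threeCorners` and `anyCorner` the budget is met with equality, 14 against 14.
  nodeProfiles-finish : All (λ P → Any (λ g → Any (Finishes P g) (atMostOne sides)) (guarantees P)) nodeProfiles
  nodeProfiles-finish = toWitness {a? =
    All.all? (λ P → Any.any? (λ g → Any.any? (finishes? P g) _) _) _} _

finish : ∀ {T t} P {g es} → es ⊆ sides → Finishes P g es → Achieves T t (rank P) g →
  ∃[ Γ ] Γ ⊆ edges T t ++ realise T sides ×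
         All (λ f → Any (GuardedBy f) Γ) (face T ∷ faces T t) ×
         7 * length Γ ≤ 2 * (3 + size t)
finish {T} {t} P {g} {es} es⊆ (cheap , met , some) a =
  guards a ++ realise T es ,
  ++⁺ (internal a) (map⁺ (map T T) es⊆) ,
  guardedAt T _ (All.lookup covered (proj₁ (proj₂ (find some)))) ∷
    guarding a (xs⊆xs++ys _ _) (All.map (All.lookup (All.++⁻ˡ (ends es) covered)) met) ,
  +-cancelˡ-≤ (2 * rank P + 7 * cost g) _ _ (begin
    2 * rank P + 7 * cost g + 7 * length (guards a ++ realise T es)
      ≡⟨ cong (λ l → 2 * rank P + 7 * cost g + 7 * l)
           (trans (length-++ (guards a)) (cong (length (guards a) +_) (length-map (map T T) es))) ⟩
    2 * rank P + 7 * cost g + 7 * (length (guards a) + length es)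
      ≡⟨ rearrange₁ (rank P) (cost g) (length (guards a)) (length es) ⟩
    (7 * length (guards a) + 2 * rank P) + 7 * (length es + cost g)
      ≤⟨ +-mono-≤ (few a) cheap ⟩
    (2 * size t + 7 * cost g) + 2 * (3 + rank P)
      ≡⟨ rearrange₂ (rank P) (cost g) (size t) ⟩
    2 * rank P + 7 * cost g + 2 * (3 + size t) ∎)
  where
  open ≤-Reasoning

  rearrange₁ : ∀ r k l e → 2 * r + 7 * k + 7 * (l + e) ≡ (7 * l + 2 * r) + 7 * (e + k)
  rearrange₁ = solve-∀

  rearrange₂ : ∀ r k s → (2 * s + 7 * k) + 2 * (3 + r) ≡ 2 * r + 7 * k + 2 * (3 + s)
  rearrange₂ = solve-∀

  covered : All (Covered (guards a ++ realise T es) ∘ T) (ends es ++ provided g)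
  covered = All.++⁺
    (All.map (Any-resp-⊆ (xs⊆ys++xs _ (guards a))) (ends-covered T es))
    (All.map (Any-resp-⊆ (xs⊆xs++ys _ _)) (covering a))

-- From the stacking process to its tree.

++-split : ∀ {A : Set} (xs : List A) {ys ps qs : List A} {z} → xs ++ ys ≡ ps ++ z ∷ qs →
  (∃[ rs ] xs ≡ ps ++ z ∷ rs × qs ≡ rs ++ ys) ⊎ (∃[ rs ] ps ≡ xs ++ rs × ys ≡ rs ++ z ∷ qs)
++-split []       {ps = ps}     eq   = inj₂ (ps , refl , eq)
++-split (x ∷ xs) {ps = []}     refl = inj₁ (xs , refl , refl)
++-split (x ∷ xs) {ps = p ∷ ps} eq with refl , eq′ ← ∷-injective eq =
  Sum.map (map₂ (map₁ (cong (p ∷_)))) (map₂ (map₁ (cong (p ∷_)))) (++-split xs eq′)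

-- The edges added by a stacking step arise deep inside one subtree; these two inclusions carry them
-- to the front, past the blocks on either side.
absorbˡ : ∀ {A : Set} (ns : List A) {xs′ xs ys} → xs′ ⊆ ns ++ xs → xs′ ++ ys ⊆ ns ++ xs ++ ys
absorbˡ ns {xs = xs} {ys} sub = ⊆-trans (++⁺ sub ⊆-refl) (⊆-reflexive (++-assoc ns xs ys))

absorbʳ : ∀ {A : Set} (ns xs : List A) {ys′ ys} → ys′ ⊆ ns ++ ys → xs ++ ys′ ⊆ ns ++ xs ++ ys
absorbʳ ns xs sub m with ∈-++⁻ xs m
... | inj₁ m∈xs = ∈-++⁺ʳ ns (∈-++⁺ˡ m∈xs)
... | inj₂ m∈ys′ with ∈-++⁻ ns (sub m∈ys′)
...   | inj₁ m∈ns = ∈-++⁺ˡ m∈ns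
...   | inj₂ m∈ys = ∈-++⁺ʳ ns (∈-++⁺ʳ xs m∈ys)

-- Faces are tracked exactly and in order, because the next stacking step names its face by
-- position; edges are tracked by inclusion, which is what membership of the guards in `E` asks for.
record Insertion (T : Triangle) (t : Tree) (ps qs : List Face) (x y z n : Vertex) : Set where
  field
    tree       : Tree
    new-faces  : faces T tree ≡ ps ++ (x , y , n) ∷ (y , z , n) ∷ (x , z , n) ∷ qs
    new-edges  : edges T tree ⊆ (x , n) ∷ (y , n) ∷ (z , n) ∷ edges T t
    new-size   : size tree ≡ suc (size t)
open Insertion

insert : ∀ T t ps {qs x y z} n → faces T t ≡ ps ++ (x , y , z) ∷ qs → Insertion T t ps qs x y z n
insert T leaf [] n refl = record
  { tree      = node n leaf leaf leaf
  ; new-faces = refl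
  ; new-edges = ⊆-refl
  ; new-size  = refl
  }
insert T leaf (_ ∷ []) n ()
insert T leaf (_ ∷ _ ∷ _) n ()
insert T (node v t₁ t₂ t₃) ps {qs} {x} {y} {z} n eq = split (++-split F₁ eq)
  where
  T₁ T₂ T₃ : Triangle
  T₁ = extend T v ∘ sub₁
  T₂ = extend T v ∘ sub₂
  T₃ = extend T v ∘ sub₃

  F₁ F₂ F₃ : List Face
  F₁ = faces T₁ t₁
  F₂ = faces T₂ t₂
  F₃ = faces T₃ t₃

  S N : List Edge
  S = realise (extend T v) spokes
  N = (x , n) ∷ (y , n) ∷ (z , n) ∷ []

  split : _ → Insertion T (node v t₁ t₂ t₃) ps qs x y z n
  split (inj₁ (rs , eq₁ , refl)) = record
    { tree      = node v (tree ins) t₂ t₃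
    ; new-faces = trans (cong (_++ F₂ ++ F₃) (new-faces ins)) (++-assoc ps _ _)
    ; new-edges = absorbʳ N S (absorbˡ N (new-edges ins))
    ; new-size  = cong (λ s → suc (s + size t₂ + size t₃)) (new-size ins)
    }
    where ins = insert T₁ t₁ ps n eq₁
  split (inj₂ (rs , refl , eq′)) with ++-split F₂ eq′
  ... | inj₁ (rs′ , eq₂ , refl) = record
    { tree      = node v t₁ (tree ins) t₃
    ; new-faces = trans (cong (λ F → F₁ ++ F ++ F₃) (new-faces ins))
                    (trans (cong (F₁ ++_) (++-assoc rs _ _)) (sym (++-assoc F₁ rs _)))
    ; new-edges = absorbʳ N S (absorbʳ N (edges T₁ t₁) (absorbˡ N (new-edges ins)))
    ; new-size  = trans (cong (λ s → suc (size t₁ + s + size t₃)) (new-size ins))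
                    (cong (λ s → suc (s + size t₃)) (+-suc _ _))
    }
    where ins = insert T₂ t₂ rs n eq₂
  ... | inj₂ (rs′ , refl , eq₃) = record
    { tree      = node v t₁ t₂ (tree ins)
    ; new-faces = trans (cong (λ F → F₁ ++ F₂ ++ F) (new-faces ins))
                    (trans (cong (F₁ ++_) (sym (++-assoc F₂ rs′ _))) (sym (++-assoc F₁ (F₂ ++ rs′) _)))
    ; new-edges = absorbʳ N S (absorbʳ N (edges T₁ t₁) (absorbʳ N (edges T₂ t₂) (new-edges ins)))
    ; new-size  = trans (cong (λ s → suc (size t₁ + size t₂ + s)) (new-size ins)) (cong suc (+-suc _ _))
    }
    where ins = insert T₃ t₃ rs′ n eq₃

-- Induction on the construction, replacing one leaf per stacking step. The outer triangle is `toℕ`,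
-- with corners 0, 1, 2; its sides are listed apart, as `edges` holds interior edges only.
reconstruct : ∀ {n E F} → Stacked n E F →
  ∃[ t ] faces toℕ t ≡ F × edges toℕ t ++ realise toℕ sides ⊆ E × n ≡ 3 + size t
reconstruct triangle = leaf , refl , ⊆-refl , refl
reconstruct (stack {n} F₁ F₂ x y z st) with t , faces≡ , edges⊆ , refl ← reconstruct st =
  tree ins , new-faces ins ,
  ⊆-trans (absorbˡ N (new-edges ins)) (++⁺ (⊆-refl {x = N}) edges⊆) ,
  cong (3 +_) (sym (new-size ins))
  where
  N   = (x , n) ∷ (y , n) ∷ (z , n) ∷ []
  ins = insert toℕ t F₁ n faces≡

-- Assembling the bound for n at least 4.

node-guarded : ∀ T v t₁ t₂ t₃ → let t = node v t₁ t₂ t₃ in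
  ∃[ Γ ] Γ ⊆ edges T t ++ realise T sides ×
         All (λ f → Any (GuardedBy f) Γ) (face T ∷ faces T t) ×
         7 * length Γ ≤ 2 * (3 + size t)
node-guarded T v t₁ t₂ t₃ =
  let P , P∈ , at   = node-attains T v t₁ t₂ t₃
      _ , g∈ , any  = find (All.lookup nodeProfiles-finish P∈)
      _ , es∈ , fin = find any
  in finish P (atMostOne-⊆ es∈) fin (All.lookup at g∈)

m*n≤o⇒n≤o/m : ∀ m n o .{{_ : NonZero m}} → m * n ≤ o → n ≤ o / m
m*n≤o⇒n≤o/m m n o mn≤o = begin
  n         ≡⟨ m*n/n≡m n m ⟨
  n * m / m ≡⟨ cong (_/ m) (*-comm n m) ⟩
  m * n / m ≤⟨ /-monoˡ-≤ m mn≤o ⟩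
  o / m     ∎
  where open ≤-Reasoning

theorem5 : (n : ℕ) (E : List Edge) (F : List Face) → Stacked n E F → 4 ≤ n →
    ∃[ Γ ] (IsEdgeGuardSet E (outerFace ∷ F) Γ × length Γ ≤ (2 * n) / 7)
theorem5 n E F st 4≤n with reconstruct st
-- A leaf at the root means n = 3.
theorem5 _ E F st (s≤s (s≤s (s≤s ()))) | leaf , _ , _ , refl
... | node v t₁ t₂ t₃ , refl , edges⊆ , refl =
  let Γ , Γ⊆ , guarded , few′ = node-guarded toℕ v t₁ t₂ t₃
  in Γ , (⊆-trans Γ⊆ edges⊆ , guarded) , m*n≤o⇒n≤o/m 7 (length Γ) _ few′
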